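{- Let $G$ be a graph of order $n \geq 6$, and let $\overline{G}$ be its complement. Then $$8 \leq b_{\rm g}'(G)\, b_{\rm g}'(\overline{G}) \leq 3n-6.$$
   Context: All graphs are finite, simple and undirected; the order of a graph is its number of vertices. The burning game on a graph $G$ is played by two players, Burner and Staller, in rounds $t=1,2,3,\dots$. Initially (round $0$) all vertices are unburned. Each round $t\ge 1$ consists of two phases: first, in the spreading phase, every unburned vertex having a burning neighbor starts to burn (fire spreads simultaneously, by distance one, from all burning vertices); then, in the selection phase, if unburned vertices remain, the player whose turn it is chooses one unburned vertex, which starts to burn. Burning vertices stay burning forever. The players alternate: one of them selects in the odd rounds, the other in the even rounds. The game ends in the first round in which all vertices of $G$ are burning (possibly already after the spreading phase of that round). Burner wants to minimize the number of rounds and Staller wants to maximize it. If both play optimally, the number of rounds is denoted $b_{\rm g}'(G)$ (the Staller-start game burning number) when Staller makes the first move (selects in round 1). -}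

module Defs where

open import Data.Bool.Base using (if_then_else_)
open import Data.Fin.Base using (Fin)
open import Data.Fin.Properties using (any?) renaming (_≟_ to _≟ᶠ_)
open import Data.Fin.Subset
  using (Subset; _∈_; _∉_; _⊆_; _∪_; ⁅_⁆; ∣_∣; ⊥; ⊤)
open import Data.Fin.Subset.Properties
  using (_∈?_; ∈⊤; ∣p∣≤n; ∣p∣≡n⇒p≡⊤; p⊂q⇒∣p∣<∣q∣; p⊆p∪q; q⊆p∪q; x∈⁅x⁆)
open import Data.List.Base using (List; []; _∷_; map; filter; null; allFin)
open import Data.List.Extrema.Nat using (min; max)
open import Data.List.Properties using (map-cong-local)
import Data.List.Relation.Unary.All as All
open import Data.List.Relation.Unary.All.Properties using (all-filter)
open import Data.Nat.Base using (ℕ; zero; suc; _≤_; _+_)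
open import Data.Nat.Properties
  using (≤-antisym; ≤-trans; ≤-reflexive; +-identityʳ; +-suc; +-monoˡ-≤)
open import Data.Product.Base using (_×_; _,_; ∃-syntax)
open import Data.Sum.Base using (_⊎_; inj₁)
open import Data.Vec.Base using (tabulate)
open import Data.Vec.Properties using (lookup⇒[]=; lookup∘tabulate)
open import Level using (0ℓ)
open import Relation.Binary.Core using (Rel)
open import Relation.Binary.Definitions using (Symmetric; Irreflexive; Decidable)
open import Relation.Binary.PropositionalEquality
  using (_≡_; _≢_; refl; sym; trans; cong; subst; ≢-sym)
open import Relation.Nullary using (¬_; Dec; does; yes; no; contradiction)
open import Relation.Nullary.Decidable
  using (¬?; _×-dec_; _⊎-dec_; dec-true)

record Graph (n : ℕ) : Set₁ where
  field
    _~_      : Rel (Fin n) 0ℓ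
    ~-sym    : Symmetric _~_
    ~-irrefl : Irreflexive _≡_ _~_
    _~?_     : Decidable _~_

complement : ∀ {n} → Graph n → Graph n
complement G = record
  { _~_      = λ u v → u ≢ v × ¬ (u ~ v)
  ; ~-sym    = λ (u≢v , u≁v) → ≢-sym u≢v , λ v~u → u≁v (~-sym v~u)
  ; ~-irrefl = λ u≡v (u≢v , _) → u≢v u≡v
  ; _~?_     = λ u v → ¬? (u ≟ᶠ v) ×-dec ¬? (u ~? v)
  }
  where open Graph G

data Player : Set where
  burner staller : Player

opponent : Player → Player
opponent burner  = staller
opponent staller = burner

-- The value, to the player about to choose, of a list of options. The empty
-- list stands for a round in which there is nothing left to select, so that
-- no further round follows.
best : Player → List ℕ → ℕ
best _       []       = 0
best burner  (x ∷ xs) = min x xs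
best staller (x ∷ xs) = max x xs

unburned : ∀ {n} → Subset n → List (Fin n)
unburned {n} B = filter (λ v → ¬? (v ∈? B)) (allFin n)

module _ {n : ℕ} (G : Graph n) where
  open Graph G

  BurnsNext : Subset n → Fin n → Set
  BurnsNext B v = v ∈ B ⊎ (∃[ u ] u ∈ B × u ~ v)

  burnsNext? : ∀ B v → Dec (BurnsNext B v)
  burnsNext? B v = v ∈? B ⊎-dec any? (λ u → u ∈? B ×-dec u ~? v)

  spread : Subset n → Subset n
  spread B = tabulate (λ v → does (burnsNext? B v))

  -- rounds p k B is the number of rounds still to be played under optimal play
  -- when B is burning and p selects in the coming round, cut off after k rounds.
  -- The cut-off serves structural recursion only: every round burns a new
  -- vertex, so it has no effect once n ≤ ∣ B ∣ + k (see rounds-stable).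
  rounds : Player → ℕ → Subset n → ℕ
  rounds p zero    B = 0
  rounds p (suc k) B =
    if null (unburned B) then 0
    else suc (best p (map (λ v → rounds (opponent p) k (spread B ∪ ⁅ v ⁆))
                          (unburned (spread B))))

  bg′ : ℕ
  bg′ = rounds staller n ⊥

  ⊆-spread : ∀ B → B ⊆ spread B
  ⊆-spread B {v} v∈B = lookup⇒[]= v (spread B)
    (trans (lookup∘tabulate _ v) (dec-true (burnsNext? B v) (inj₁ v∈B)))

  ∣B∣<∣next∣ : ∀ B {v} → v ∉ spread B → suc ∣ B ∣ ≤ ∣ spread B ∪ ⁅ v ⁆ ∣
  ∣B∣<∣next∣ B {v} v∉ = p⊂q⇒∣p∣<∣q∣
    ( (λ x∈B → p⊆p∪q ⁅ v ⁆ (⊆-spread B x∈B))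
    , v , q⊆p∪q (spread B) ⁅ v ⁆ (x∈⁅x⁆ v) , λ v∈B → v∉ (⊆-spread B v∈B))

  rounds-stable : ∀ p k B → n ≤ ∣ B ∣ + k → rounds p (suc k) B ≡ rounds p k B
  rounds-stable p zero B n≤
    with unburned B | all-filter (λ v → ¬? (v ∈? B)) (allFin n)
  ... | []    | _            = refl
  ... | v ∷ _ | v∉B All.∷ _ = contradiction (subst (v ∈_) (sym B≡⊤) ∈⊤) v∉B
    where
    B≡⊤ : B ≡ ⊤
    B≡⊤ = ∣p∣≡n⇒p≡⊤
      (≤-antisym (∣p∣≤n B) (≤-trans n≤ (≤-reflexive (+-identityʳ ∣ B ∣))))
  rounds-stable p (suc k) B n≤ =
    cong (λ xs → if null (unburned B) then 0 else suc (best p xs))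
      (map-cong-local (All.map
        (λ {v} v∉ → rounds-stable (opponent p) k (spread B ∪ ⁅ v ⁆)
          (≤-trans n≤ (≤-trans (≤-reflexive (+-suc ∣ B ∣ k))
                               (+-monoˡ-≤ k (∣B∣<∣next∣ B v∉)))))
        (all-filter (λ v → ¬? (v ∈? spread B)) (allFin n))))

{-# OPTIONS --safe #-}

-- If two vertices v, r are at distance at least 3 in G, they dominate the
-- complement H: Staller's first vertex sets one of them alight, Burner can pick
-- the other, and H is burnt in round 3; if there is no such pair, G is burnt in
-- round 3 whatever Burner does. Hence one of the two numbers is at most 3.
-- If the other graph has a vertex of degree at least 2, Burner gains two rounds there, which gives
-- 3(n − 2). Otherwise that graph has maximum degree at most 1, the numbers are
-- at most n and 2, and 2n ≤ 3n − 6. For the lower bound, a vertex of degree at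
-- least 2 forces 3 rounds on the complement, while a graph of maximum degree
-- at most 1 burns at most 2t − 1 vertices in t rounds, so it lasts 4 rounds.
module Submission where

open import Defs
open import Data.Bool.Base using (true; false)
open import Data.Fin.Base using (Fin; zero; suc)
open import Data.Fin.Properties using (any?; ¬∀⟶∃¬) renaming (_≟_ to _≟ᶠ_)
open import Data.Fin.Subset
  using (Subset; _∈_; _∉_; _⊆_; _∪_; ⁅_⁆; ∣_∣; ⊥; ⊤)
open import Data.Fin.Subset.Properties
  using ( _∈?_; ∉⊥; ∈⊤; ∣⊥∣≡0; ∣⁅x⁆∣≡1; ∣⊤∣≡n; ∣p∣≡n⇒p≡⊤; ∣p∣≤n
        ; p⊆q⇒∣p∣≤∣q∣; p⊂q⇒∣p∣<∣q∣; p⊆p∪q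
        ; x∈⁅x⁆; x∈⁅y⁆⇒x≡y; x∈p∪q⁺; x∈p∪q⁻; ∪-identityʳ
        ; x∈p⇒∣p-x∣<∣p∣; x∈p∧x≢y⇒x∈p-y)
open import Data.List.Base using ([]; _∷_; map; null; allFin; length)
open import Data.List.Extrema.Nat using (max≤v⁺; min≤v⁺; v≤max⁺; v≤min⁺)
open import Data.List.Membership.Propositional using (lose) renaming (_∈_ to _∈ˡ_)
open import Data.List.Membership.Propositional.Properties
  using (∈-filter⁺; ∈-map⁺; ∈-allFin)
open import Data.List.Properties using (filter-none)
open import Data.List.Relation.Unary.All as All using (All; []; _∷_)
open import Data.List.Relation.Unary.All.Properties as All using (all-filter)
open import Data.List.Relation.Unary.AllPairs using ([]; _∷_)
open import Data.List.Relation.Unary.Any using (here; there)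
open import Data.List.Relation.Unary.Unique.Propositional using (Unique)
open import Data.Nat.Base using (ℕ; zero; suc; _≤_; _<_; _+_; _*_; _∸_; z≤n; s≤s)
open import Data.Nat.Properties
  using ( ≤-antisym; ≤-trans; ≤-reflexive; ≤-refl; <⇒≱; <⇒≤; n≤1+n; m≤m+n; m≤n+m; +-identityʳ
        ; +-suc; +-assoc; +-comm; +-monoˡ-≤; +-monoʳ-≤; *-mono-≤; *-comm; *-distribˡ-∸
        ; m+n≤o⇒m≤o∸n; m+[n∸m]≡n; m≤n+m∸n)
open import Data.Product.Base using (_×_; _,_; ∃-syntax)
open import Data.Sum.Base using (_⊎_; inj₁; inj₂; swap)
open import Data.Vec.Base using (_∷_)
open import Data.Vec.Properties using (lookup⇒[]=; []=⇒lookup; lookup∘tabulate)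
open import Level using (0ℓ)
open import Function.Base using (_∘_)
open import Relation.Binary.PropositionalEquality
  using (_≡_; _≢_; refl; sym; trans; cong; subst; ≢-sym)
open import Relation.Nullary using (¬_; Dec; yes; no; contradiction)
open import Relation.Nullary.Decidable
  using (¬?; _×-dec_; _⊎-dec_; dec-true; dec-false; decidable-stable)
open import Relation.Unary using (Pred)

-- Sizes of subsets.

∣p∪⁅x⁆∣≤1+∣p∣ : ∀ {n} (p : Subset n) x → ∣ p ∪ ⁅ x ⁆ ∣ ≤ suc ∣ p ∣
∣p∪⁅x⁆∣≤1+∣p∣ (true  ∷ p) zero rewrite ∪-identityʳ p = n≤1+n _
∣p∪⁅x⁆∣≤1+∣p∣ (false ∷ p) zero rewrite ∪-identityʳ p = ≤-refl
∣p∪⁅x⁆∣≤1+∣p∣ (true  ∷ p) (suc x) = s≤s (∣p∪⁅x⁆∣≤1+∣p∣ p x)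
∣p∪⁅x⁆∣≤1+∣p∣ (false ∷ p) (suc x) = ∣p∪⁅x⁆∣≤1+∣p∣ p x

-- Deleting the head from `p` lowers its size, and the remaining entries, being distinct from it,
-- survive. This serves to count burning vertices that are listed by name.
unique⇒length≤∣p∣ : ∀ {n} {p : Subset n} {xs} →
                    Unique xs → All (_∈ p) xs → length xs ≤ ∣ p ∣
unique⇒length≤∣p∣ []           []           = z≤n
unique⇒length≤∣p∣ (x≢xs ∷ uxs) (x∈p ∷ xs⊆p) =
  ≤-trans (s≤s (unique⇒length≤∣p∣ uxs
            (All.zipWith (λ (y∈p , x≢y) → x∈p∧x≢y⇒x∈p-y y∈p (≢-sym x≢y)) (xs⊆p , x≢xs))))
          (x∈p⇒∣p-x∣<∣p∣ x∈p)

∣p∣<n⇒∃∉ : ∀ {n} {p : Subset n} → ∣ p ∣ < n → ∃[ v ] v ∉ p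
∣p∣<n⇒∃∉ {n} {p} ∣p∣<n = ¬∀⟶∃¬ n (_∈ p) (_∈? p) λ all∈p →
  <⇒≱ ∣p∣<n (subst (_≤ ∣ p ∣) (∣⊤∣≡n n) (p⊆q⇒∣p∣≤∣q∣ {p = ⊤} λ _ → all∈p _))

-- Values of `best`, and the vertices still unburned.

best-≤ : ∀ p {m xs} → All (_≤ m) xs → best p xs ≤ m
best-≤ p       []         = z≤n
best-≤ burner  {xs = _ ∷ xs} (x≤ ∷ xs≤) = min≤v⁺ _ xs (inj₁ x≤)
best-≤ staller (x≤ ∷ xs≤) = max≤v⁺ x≤ xs≤

best-burner-≤ : ∀ {m x xs} → x ∈ˡ xs → x ≤ m → best burner xs ≤ m
best-burner-≤ {xs = _ ∷ xs} (here refl)  x≤m = min≤v⁺ _ xs (inj₁ x≤m)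
best-burner-≤ {xs = _ ∷ xs} (there x∈xs) x≤m = min≤v⁺ _ xs (inj₂ (lose x∈xs x≤m))

-- The membership excludes the empty list, whose value is 0.
≤-best : ∀ p {m x xs} → x ∈ˡ xs → All (m ≤_) xs → m ≤ best p xs
≤-best burner  {xs = _ ∷ _} _ (≤x ∷ ≤xs) = v≤min⁺ ≤x ≤xs
≤-best staller {xs = _ ∷ xs} _ (≤x ∷ ≤xs) = v≤max⁺ _ xs (inj₁ ≤x)

≤-best-staller : ∀ {m x xs} → x ∈ˡ xs → m ≤ x → m ≤ best staller xs
≤-best-staller {xs = _ ∷ xs} (here refl)  m≤x = v≤max⁺ _ xs (inj₁ m≤x)
≤-best-staller {xs = _ ∷ xs} (there x∈xs) m≤x = v≤max⁺ _ xs (inj₂ (lose x∈xs m≤x))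

∈-unburned : ∀ {n} {B : Subset n} {v} → v ∉ B → v ∈ˡ unburned B
∈-unburned {B = B} {v} = ∈-filter⁺ (λ v → ¬? (v ∈? B)) (∈-allFin v)

all-unburned : ∀ {n} {B : Subset n} {f : Fin n → ℕ} {P : Pred ℕ 0ℓ} →
               (∀ {v} → v ∉ B → P (f v)) → All P (map f (unburned B))
all-unburned {n} {B} h =
  All.map⁺ (All.map h (all-filter (λ v → ¬? (v ∈? B)) (allFin n)))

null-unburned-true : ∀ {n} {B : Subset n} → (∀ v → v ∈ B) → null (unburned B) ≡ true
null-unburned-true {n} {B} full =
  cong null (filter-none (λ v → ¬? (v ∈? B))
    (All.tabulate {xs = allFin n} λ {v} _ v∉B → v∉B (full v)))

null-unburned-false : ∀ {n} {B : Subset n} {v} → v ∉ B → null (unburned B) ≡ false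
null-unburned-false {B = B} v∉B with unburned B | ∈-unburned v∉B
... | _ ∷ _ | _ = refl

-- The spread of fire in one round.

module Burning {n : ℕ} (G : Graph n) where
  open Graph G

  next : Subset n → Fin n → Subset n
  next B v = spread G B ∪ ⁅ v ⁆

  ∈-spread⁺ : ∀ {B v} → BurnsNext G B v → v ∈ spread G B
  ∈-spread⁺ {B} {v} b = lookup⇒[]= v _
    (trans (lookup∘tabulate _ v) (dec-true (burnsNext? G B v) b))

  ∈-spread⁻ : ∀ {B v} → v ∈ spread G B → BurnsNext G B v
  ∈-spread⁻ {B} {v} v∈ = decidable-stable (burnsNext? G B v) λ ¬b →
    contradiction
      (trans (sym ([]=⇒lookup v∈))
        (trans (lookup∘tabulate _ v) (dec-false (burnsNext? G B v) ¬b)))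
      λ ()

  spread-edge : ∀ {B u v} → u ∈ B → u ~ v → v ∈ spread G B
  spread-edge u∈B u~v = ∈-spread⁺ (inj₂ (_ , u∈B , u~v))

  spread⊆next : ∀ {B v} → spread G B ⊆ next B v
  spread⊆next = x∈p∪q⁺ ∘ inj₁

  v∈next : ∀ {B v} → v ∈ next B v
  v∈next = x∈p∪q⁺ (inj₂ (x∈⁅x⁆ _))

  ∈-next⁻ : ∀ {B v x} → x ∈ next B v → x ∈ spread G B ⊎ x ≡ v
  ∈-next⁻ x∈ with x∈p∪q⁻ _ _ x∈
  ... | inj₁ x∈S = inj₁ x∈S
  ... | inj₂ x∈v = inj₂ (x∈⁅y⁆⇒x≡y _ x∈v)

  ∉-spread-⊥ : ∀ {v} → v ∉ spread G ⊥
  ∉-spread-⊥ v∈ with ∈-spread⁻ v∈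
  ... | inj₁ v∈⊥           = ∉⊥ v∈⊥
  ... | inj₂ (_ , u∈⊥ , _) = ∉⊥ u∈⊥

  ∈-next-⊥⁻ : ∀ {v x} → x ∈ next ⊥ v → x ≡ v
  ∈-next-⊥⁻ x∈ with ∈-next⁻ x∈
  ... | inj₁ x∈S = contradiction x∈S ∉-spread-⊥
  ... | inj₂ x≡v = x≡v

  ∈-spread-next-⊥⁻ : ∀ {v x} → x ∈ spread G (next ⊥ v) → x ≡ v ⊎ v ~ x
  ∈-spread-next-⊥⁻ x∈ with ∈-spread⁻ x∈
  ... | inj₁ x∈B = inj₁ (∈-next-⊥⁻ x∈B)
  ... | inj₂ (u , u∈B , u~x) rewrite ∈-next-⊥⁻ u∈B = inj₂ u~x

  -- Upper and lower bounds on the length of the game.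

  EndsWithin : Player → ℕ → Subset n → Set
  EndsWithin p m B = ∀ k → rounds G p k B ≤ m

  -- The premise m ≤ k keeps the cut-off from interfering.
  Lasts : Player → ℕ → Subset n → Set
  Lasts p m B = ∀ k → m ≤ k → m ≤ rounds G p k B

  ends-now : ∀ {p B} → (∀ v → v ∈ B) → EndsWithin p 0 B
  ends-now full zero = z≤n
  ends-now {B = B} full (suc k) rewrite null-unburned-true full = z≤n

  ends-all : ∀ {p m B} → (∀ {v} → v ∉ spread G B → EndsWithin (opponent p) m (next B v)) →
             EndsWithin p (suc m) B
  ends-all h zero = z≤n
  ends-all {p} {B = B} h (suc k) with null (unburned B)
  ... | true  = z≤n
  ... | false = s≤s (best-≤ p (all-unburned λ v∉ → h v∉ k))

  -- Nothing is left to select, but the round in which the last vertices catch fire still counts,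
  -- hence `suc m`.
  ends-full : ∀ {p m B} → (∀ v → v ∈ spread G B) → EndsWithin p (suc m) B
  ends-full full = ends-all λ {v} v∉ → contradiction (full v) v∉

  ends-burner : ∀ {m B v} → v ∉ spread G B → EndsWithin staller m (next B v) →
                EndsWithin burner (suc m) B
  ends-burner v∉ h zero = z≤n
  ends-burner {B = B} v∉ h (suc k) with null (unburned B)
  ... | true  = z≤n
  ... | false = s≤s (best-burner-≤ (∈-map⁺ _ (∈-unburned v∉)) (h k))

  -- Each round with a selection burns at least the selected vertex.
  ends-size : ∀ p m B → n ≤ ∣ B ∣ + m → EndsWithin p m B
  ends-size p zero B n≤ = ends-now λ v → subst (v ∈_) (sym B≡⊤) ∈⊤
    where
    B≡⊤ : B ≡ ⊤
    B≡⊤ = ∣p∣≡n⇒p≡⊤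
      (≤-antisym (∣p∣≤n B) (≤-trans n≤ (≤-reflexive (+-identityʳ ∣ B ∣))))
  ends-size p (suc m) B n≤ = ends-all λ {v} v∉ → ends-size (opponent p) m (next B v)
    (≤-trans n≤ (≤-trans (≤-reflexive (+-suc ∣ B ∣ m)) (+-monoˡ-≤ m (∣B∣<∣next∣ G B v∉))))

  lasts-1 : ∀ {p B v} → v ∉ B → Lasts p 1 B
  lasts-1 {B = B} v∉B (suc k) _ rewrite null-unburned-false v∉B = s≤s z≤n

  -- The vertex `v` certifies that the game is not over and that the list of options is nonempty.
  lasts-all : ∀ {p m B v} → v ∉ spread G B →
              (∀ {w} → w ∉ spread G B → Lasts (opponent p) m (next B w)) →
              Lasts p (suc m) B
  lasts-all {p} {B = B} v∉ h (suc k) (s≤s m≤k)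
    rewrite null-unburned-false (v∉ ∘ ⊆-spread G B) =
    s≤s (≤-best p (∈-map⁺ _ (∈-unburned v∉)) (all-unburned λ w∉ → h w∉ k m≤k))

  lasts-staller : ∀ {m B v} → v ∉ spread G B → Lasts burner m (next B v) →
                  Lasts staller (suc m) B
  lasts-staller {B = B} v∉ h (suc k) (s≤s m≤k)
    rewrite null-unburned-false (v∉ ∘ ⊆-spread G B) =
    s≤s (≤-best-staller (∈-map⁺ _ (∈-unburned v∉)) (h k m≤k))

  bg′≤n : bg′ G ≤ n
  bg′≤n = ends-size staller n ⊥ (m≤n+m n _) n

  -- Nothing spreads in round 1, so it burns a single vertex.
  2≤bg′ : 2 ≤ n → 2 ≤ bg′ G
  2≤bg′ 2≤n with v , _ ← ∣p∣<n⇒∃∉ {p = ⊥} (subst (_< n) (sym (∣⊥∣≡0 n)) (<⇒≤ 2≤n)) =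
    lasts-all {staller} {v = v} ∉-spread-⊥ (λ {w} _ → after w) n 2≤n
    where
    after : ∀ w → Lasts burner 1 (next ⊥ w)
    after w with u , u∉ ← ∣p∣<n⇒∃∉ {p = ⁅ w ⁆} (subst (_< n) (sym (∣⁅x⁆∣≡1 w)) 2≤n) =
      lasts-1 {v = u} λ u∈ → u∉ (subst (_∈ ⁅ w ⁆) (sym (∈-next-⊥⁻ u∈)) (x∈⁅x⁆ w))

  -- Cherries, that is, vertices of degree at least 2, and the bound n - 2.

  Cherry : Set
  Cherry = ∃[ c ] ∃[ a ] ∃[ b ] a ≢ b × c ~ a × c ~ b

  cherry? : Dec Cherry
  cherry? = any? λ c → any? λ a → any? λ b → ¬? (a ≟ᶠ b) ×-dec (c ~? a) ×-dec (c ~? b)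

  nbr-unique : ¬ Cherry → ∀ {c a b} → c ~ a → c ~ b → a ≡ b
  nbr-unique ¬ch {c} {a} {b} c~a c~b =
    decidable-stable (a ≟ᶠ b) λ a≢b → ¬ch (c , a , b , a≢b , c~a , c~b)

  -- Four vertices burn after the spreading phase and Staller selects a fifth, which leaves at most
  -- `j` vertices and so at most `j` further rounds.
  ends-four : ∀ j {B} → n ≤ 5 + j → 4 ≤ ∣ spread G B ∣ → EndsWithin staller (suc j) B
  ends-four j {B} n≤5+j 4≤ = ends-all λ {v} v∉ → ends-size burner j (next B v)
    (≤-trans n≤5+j (+-monoˡ-≤ j (≤-trans (s≤s 4≤)
      (p⊂q⇒∣p∣<∣q∣ (spread⊆next , v , v∈next , v∉)))))

  -- Burner's reply in round 2 ensures that at least four vertices burn after the spreading phase of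
  -- round 3, or that the game is then over. By `ends-four` at most 3 + (n - 5) rounds are played.
  bg′≤n∸2 : 5 ≤ n → Cherry → bg′ G ≤ n ∸ 2
  bg′≤n∸2 5≤n (c , a , b , a≢b , c~a , c~b) =
    ≤-trans (ends-all {m = 2 + j} (λ {v} _ → reply v) n)
            (≤-reflexive (cong (_∸ 2) (m+[n∸m]≡n 5≤n)))
    where
    j : ℕ
    j = n ∸ 5
    n≤5+j : n ≤ 5 + j
    n≤5+j = m≤n+m∸n n 5
    c≢a : c ≢ a
    c≢a refl = ~-irrefl refl c~a
    c≢b : c ≢ b
    c≢b refl = ~-irrefl refl c~b

    reply : ∀ v → EndsWithin burner (2 + j) (next ⊥ v)
    reply v with c ∈? spread G (next ⊥ v)
    -- Burner lights the centre; `v`, `c`, `a`, `b` are the four vertices.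
    ... | no c∉ = ends-burner c∉ (ends-four j n≤5+j (unique⇒length≤∣p∣
            ((v≢c ∷ v≢a ∷ v≢b ∷ []) ∷ (c≢a ∷ c≢b ∷ []) ∷ (a≢b ∷ []) ∷ [] ∷ [])
            (v∈ ∷ ⊆-spread G _ v∈next ∷ spread-edge v∈next c~a ∷ spread-edge v∈next c~b ∷ [])))
      where
      v∈S : v ∈ spread G (next ⊥ v)
      v∈S = ⊆-spread G _ v∈next
      v∈ : v ∈ spread G (next (next ⊥ v) c)
      v∈ = ⊆-spread G _ (spread⊆next v∈S)
      v≢c : v ≢ c
      v≢c refl = c∉ v∈S
      -- If `v` were a leaf of the cherry, its fire would have reached `c` already.
      v≢a : v ≢ a
      v≢a refl = c∉ (spread-edge v∈next (~-sym c~a))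
      v≢b : v ≢ b
      v≢b refl = c∉ (spread-edge v∈next (~-sym c~b))
    ... | yes c∈
      with any? (λ w → ¬? (w ∈? spread G (next ⊥ v)) ×-dec ¬? (w ≟ᶠ a) ×-dec ¬? (w ≟ᶠ b))
    -- The fire at `c` takes care of `a` and `b` by round 3, so Burner lights some other vertex `w`.
    ...   | yes (w , w∉ , w≢a , w≢b) = ends-burner w∉ (ends-four j n≤5+j (unique⇒length≤∣p∣
              ((w≢c ∷ w≢a ∷ w≢b ∷ []) ∷ (c≢a ∷ c≢b ∷ []) ∷ (a≢b ∷ []) ∷ [] ∷ [])
              (⊆-spread G _ v∈next ∷ ⊆-spread G _ c∈′ ∷ spread-edge c∈′ c~a
                ∷ spread-edge c∈′ c~b ∷ [])))
      where
      c∈′ : c ∈ next (next ⊥ v) w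
      c∈′ = spread⊆next c∈
      w≢c : w ≢ c
      w≢c refl = w∉ c∈
    -- At most `a` and `b` are unburned, and both catch fire from `c` by round 3.
    ...   | no ∄w = ends-all λ {w} _ → ends-full (full w)
      where
      full : ∀ w x → x ∈ spread G (next (next ⊥ v) w)
      full w x with x ∈? spread G (next ⊥ v) | x ≟ᶠ a | x ≟ᶠ b
      ... | yes x∈ | _        | _        = ⊆-spread G _ (spread⊆next x∈)
      ... | no _   | yes refl | _        = spread-edge (spread⊆next c∈) c~a
      ... | no _   | no _     | yes refl = spread-edge (spread⊆next c∈) c~b
      ... | no x∉  | no x≢a   | no x≢b   = contradiction (x , x∉ , x≢a , x≢b) ∄w

  -- Graphs of maximum degree at most 1: the lower bound 4.

  Closed : Subset n → Set
  Closed C = ∀ {u w} → u ∈ C → u ~ w → w ∈ C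

  closed-spread : ∀ {B C} → Closed C → B ⊆ C → spread G B ⊆ C
  closed-spread cl B⊆C x∈ with ∈-spread⁻ x∈
  ... | inj₁ x∈B             = B⊆C x∈B
  ... | inj₂ (_ , u∈B , u~x) = cl (B⊆C u∈B) u~x

  -- Closed sets are unions of components. Without a cherry the component of `v` is `v` alone or a
  -- single edge, so adjoining it costs at most two vertices.
  closed-insert : ¬ Cherry → ∀ {C} → Closed C → ∀ v →
                  ∃[ C′ ] Closed C′ × C ⊆ C′ × v ∈ C′ × ∣ C′ ∣ ≤ ∣ C ∣ + 2
  closed-insert ¬ch {C} cl v with any? (v ~?_)
  ... | no v≁ = C ∪ ⁅ v ⁆ , cl′ , p⊆p∪q _ , x∈p∪q⁺ (inj₂ (x∈⁅x⁆ v))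
              , ≤-trans (∣p∪⁅x⁆∣≤1+∣p∣ C v)
                        (≤-trans (≤-reflexive (+-comm 1 ∣ C ∣)) (+-monoʳ-≤ ∣ C ∣ (s≤s z≤n)))
    where
    cl′ : Closed (C ∪ ⁅ v ⁆)
    cl′ u∈ u~w with x∈p∪q⁻ C _ u∈
    ... | inj₁ u∈C = x∈p∪q⁺ (inj₁ (cl u∈C u~w))
    ... | inj₂ u∈v rewrite x∈⁅y⁆⇒x≡y v u∈v = contradiction (_ , u~w) v≁
  ... | yes (v′ , v~v′) = (C ∪ ⁅ v ⁆) ∪ ⁅ v′ ⁆ , cl′ , p⊆p∪q _ ∘ p⊆p∪q _ , v∈
              , ≤-trans (∣p∪⁅x⁆∣≤1+∣p∣ (C ∪ ⁅ v ⁆) v′)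
                        (≤-trans (s≤s (∣p∪⁅x⁆∣≤1+∣p∣ C v)) (≤-reflexive (+-comm 2 ∣ C ∣)))
    where
    v∈ : v ∈ (C ∪ ⁅ v ⁆) ∪ ⁅ v′ ⁆
    v∈ = p⊆p∪q _ (x∈p∪q⁺ (inj₂ (x∈⁅x⁆ v)))
    cl′ : Closed ((C ∪ ⁅ v ⁆) ∪ ⁅ v′ ⁆)
    cl′ u∈ u~w with x∈p∪q⁻ (C ∪ ⁅ v ⁆) _ u∈
    ... | inj₂ u∈v′ rewrite x∈⁅y⁆⇒x≡y v′ u∈v′ | nbr-unique ¬ch u~w (~-sym v~v′) = v∈
    ... | inj₁ u∈Cv with x∈p∪q⁻ C _ u∈Cv
    ...   | inj₁ u∈C = p⊆p∪q _ (p⊆p∪q _ (cl u∈C u~w))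
    ...   | inj₂ u∈v rewrite x∈⁅y⁆⇒x≡y v u∈v | nbr-unique ¬ch u~w v~v′ =
      x∈p∪q⁺ (inj₂ (x∈⁅x⁆ v′))

  -- The fire never leaves the closed set `C` except by a selection, and adjoining the component of
  -- the selected vertex keeps the set closed. The term `j * 2` pays for `j` such components; the 2
  -- pays for one last selection and a vertex that survives it.
  lasts-no-cherry : ¬ Cherry → ∀ j p {B C} → Closed C → spread G B ⊆ C →
                    ∣ C ∣ + (2 + j * 2) ≤ n → Lasts p (2 + j) B
  lasts-no-cherry ¬ch j p {B} {C} cl S⊆C size
    with x , x∉C ← ∣p∣<n⇒∃∉ {p = C}
           (≤-trans (≤-trans (≤-reflexive (+-comm 1 ∣ C ∣)) (+-monoʳ-≤ ∣ C ∣ (s≤s z≤n))) size) =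
    lasts-all {p} (x∉C ∘ S⊆C) (λ {w} _ → after j size w)
    where
    after : ∀ j → ∣ C ∣ + (2 + j * 2) ≤ n → ∀ w → Lasts (opponent p) (1 + j) (next B w)
    -- The last selection has not spread yet, so it fills one place and not a whole component.
    after zero size w
      with y , y∉ ← ∣p∣<n⇒∃∉ {p = C ∪ ⁅ w ⁆} (≤-trans (s≤s (∣p∪⁅x⁆∣≤1+∣p∣ C w))
             (≤-trans (≤-reflexive (+-comm 2 ∣ C ∣)) size)) =
      lasts-1 λ y∈ → y∉ (next⊆ y∈)
      where
      next⊆ : next B w ⊆ C ∪ ⁅ w ⁆
      next⊆ x∈ with x∈p∪q⁻ _ _ x∈
      ... | inj₁ x∈S = x∈p∪q⁺ (inj₁ (S⊆C x∈S))
      ... | inj₂ x∈w = x∈p∪q⁺ (inj₂ x∈w)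
    after (suc j) size w
      with C′ , cl′ , C⊆C′ , w∈C′ , ∣C′∣≤ ← closed-insert ¬ch cl w =
      lasts-no-cherry ¬ch j (opponent p) cl′ (closed-spread cl′ next⊆)
        (≤-trans (+-monoˡ-≤ _ ∣C′∣≤) (≤-trans (≤-reflexive (+-assoc ∣ C ∣ 2 _)) size))
      where
      next⊆ : next B w ⊆ C′
      next⊆ x∈ with ∈-next⁻ x∈
      ... | inj₁ x∈S  = C⊆C′ (S⊆C x∈S)
      ... | inj₂ refl = w∈C′

  no-cherry⇒4≤bg′ : 6 ≤ n → ¬ Cherry → 4 ≤ bg′ G
  -- With `C` empty and `j = 2` the room required is exactly 6.
  no-cherry⇒4≤bg′ 6≤n ¬ch = lasts-no-cherry ¬ch 2 staller {C = ⊥}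
    (λ u∈ → contradiction u∈ ∉⊥) (λ x∈ → contradiction x∈ ∉-spread-⊥)
    (≤-trans (≤-reflexive (cong (_+ 6) (∣⊥∣≡0 n))) 6≤n) n
    (≤-trans (m≤m+n 4 2) 6≤n)

  -- Domination, and graphs burnt in three rounds.

  Dominates : Fin n → Fin n → Set
  Dominates u w = u ≡ w ⊎ u ~ w

  dominates? : ∀ u w → Dec (Dominates u w)
  dominates? u w = (u ≟ᶠ w) ⊎-dec (u ~? w)

  spread-dominates : ∀ {B u w} → u ∈ B → Dominates u w → w ∈ spread G B
  spread-dominates u∈B (inj₁ refl) = ⊆-spread G _ u∈B
  spread-dominates u∈B (inj₂ u~w)  = spread-edge u∈B u~w

  dominates-sym : ∀ {u w} → Dominates u w → Dominates w u
  dominates-sym (inj₁ refl) = inj₁ refl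
  dominates-sym (inj₂ u~w)  = inj₂ (~-sym u~w)

  -- Distance at most 2, since `Dominates` is reflexive.
  Near : Fin n → Fin n → Set
  Near v r = ∃[ u ] Dominates v u × Dominates u r

  near? : ∀ v r → Dec (Near v r)
  near? v r = any? λ u → dominates? v u ×-dec dominates? u r

  -- The fire from the first vertex alone covers distance 2 by the spreading phase of round 3.
  near⇒bg′≤3 : (∀ v r → Near v r) → bg′ G ≤ 3
  near⇒bg′≤3 near = ends-all {m = 2} (λ {v} _ → ends-all λ _ → ends-full λ r →
    let u , vu , ur = near v r
    in spread-dominates (spread⊆next (spread-dominates v∈next vu)) ur) n

  -- Staller's first vertex `w` is dominated by `v` or `r`, and by symmetry that one burns after the
  -- spreading phase of round 2. Burner lights the other if necessary, and round 3 burns the rest.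
  dominating-pair⇒bg′≤3 : ∀ {v r} → (∀ x → Dominates v x ⊎ Dominates r x) → bg′ G ≤ 3
  dominating-pair⇒bg′≤3 {v} {r} dom = ends-all {m = 2} (λ {w} _ → reply w) n
    where
    full : ∀ {B} → v ∈ B → r ∈ B → ∀ x → x ∈ spread G B
    full v∈ r∈ x with dom x
    ... | inj₁ vx = spread-dominates v∈ vx
    ... | inj₂ rx = spread-dominates r∈ rx

    reply : ∀ w → EndsWithin burner 2 (next ⊥ w)
    reply w with v ∈? spread G (next ⊥ w) | r ∈? spread G (next ⊥ w) | dom w
    ... | yes v∈ | yes r∈ | _       =
      ends-all λ _ → ends-full (full (spread⊆next v∈) (spread⊆next r∈))
    ... | yes v∈ | no r∉  | _       = ends-burner r∉ (ends-full (full (spread⊆next v∈) v∈next))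
    ... | no v∉  | yes r∈ | _       = ends-burner v∉ (ends-full (full v∈next (spread⊆next r∈)))
    ... | no v∉  | no _   | inj₁ vw =
      contradiction (spread-dominates v∈next (dominates-sym vw)) v∉
    ... | no _   | no r∉  | inj₂ rw =
      contradiction (spread-dominates v∈next (dominates-sym rw)) r∉

-- Complementary pairs of graphs.

open Burning using (Cherry; cherry?)

-- A symmetric relation in place of `complement`, so that the roles of the two graphs can be
-- exchanged.
record Complementary {n} (G H : Graph n) : Set where
  open Graph G
  open Graph H renaming (_~_ to _≈_)
  field
    cover    : ∀ {u v} → u ≢ v → u ~ v ⊎ u ≈ v
    disjoint : ∀ {u v} → u ~ v → ¬ u ≈ v

complementary-sym : ∀ {n} {G H : Graph n} → Complementary G H → Complementary H G
complementary-sym GH = record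
  { cover    = λ u≢v → swap (cover u≢v)
  ; disjoint = λ u≈v u~v → disjoint u~v u≈v
  }
  where open Complementary GH

complement-complementary : ∀ {n} (G : Graph n) → Complementary G (complement G)
complement-complementary G = record { cover = cover ; disjoint = λ u~v (_ , u≁v) → u≁v u~v }
  where
  open Graph G
  cover : ∀ {u v} → u ≢ v → u ~ v ⊎ (u ≢ v × ¬ u ~ v)
  cover {u} {v} u≢v with u ~? v
  ... | yes u~v = inj₁ u~v
  ... | no u≁v  = inj₂ (u≢v , u≁v)

module _ {n} {G H : Graph n} (GH : Complementary G H) where
  open Complementary GH
  open Graph G
  open Graph H using () renaming (_~_ to _≈_)
  private
    module G = Burning G
    module H = Burning H

  -- Staller opens at the centre `c`. In `H` it is adjacent to neither `a` nor `b`, so both survive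
  -- the spreading phase of round 2, and the selection takes only one of them.
  cherry⇒3≤bg′ : 3 ≤ n → Cherry G → 3 ≤ bg′ H
  cherry⇒3≤bg′ 3≤n (c , a , b , a≢b , c~a , c~b) =
    H.lasts-staller H.∉-spread-⊥ (H.lasts-all (∉-spread c~a) λ {w} _ → after w) n 3≤n
    where
    ∉-spread : ∀ {x} → c ~ x → x ∉ spread H (H.next ⊥ c)
    ∉-spread c~x x∈ with H.∈-spread-next-⊥⁻ x∈
    ... | inj₁ refl = ~-irrefl refl c~x
    ... | inj₂ c≈x  = disjoint c~x c≈x

    ∉-next : ∀ {w x} → c ~ x → x ≢ w → x ∉ H.next (H.next ⊥ c) w
    ∉-next c~x x≢w x∈ with H.∈-next⁻ x∈
    ... | inj₁ x∈S = ∉-spread c~x x∈S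
    ... | inj₂ x≡w = x≢w x≡w

    after : ∀ w → H.Lasts staller 1 (H.next (H.next ⊥ c) w)
    after w with a ≟ᶠ w
    ... | no a≢w   = H.lasts-1 (∉-next c~a a≢w)
    ... | yes refl = H.lasts-1 (∉-next c~b (≢-sym a≢b))

  -- In `H` the first vertex is adjacent to all others except its at most one neighbour in `G`,
  -- which is then the only vertex left to select in round 2.
  no-cherry⇒bg′≤2 : ¬ Cherry G → bg′ H ≤ 2
  no-cherry⇒bg′≤2 ¬ch =
    H.ends-all {m = 1} (λ {v} _ → H.ends-all λ {x} x∉ → H.ends-now (full x∉)) n
    where
    non-nbr : ∀ {v x} → x ∉ spread H (H.next ⊥ v) → v ~ x
    non-nbr {v} {x} x∉ with v ≟ᶠ x
    ... | yes refl = contradiction (⊆-spread H _ H.v∈next) x∉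
    ... | no v≢x with cover v≢x
    ...   | inj₁ v~x = v~x
    ...   | inj₂ v≈x = contradiction (H.spread-edge H.v∈next v≈x) x∉

    full : ∀ {v x} → x ∉ spread H (H.next ⊥ v) → ∀ y → y ∈ H.next (H.next ⊥ v) x
    full {v} x∉ y with y ∈? spread H (H.next ⊥ v)
    ... | yes y∈ = H.spread⊆next y∈
    ... | no y∉ rewrite G.nbr-unique ¬ch (non-nbr y∉) (non-nbr x∉) = H.v∈next

  -- A vertex dominated in `H` by neither would be a common neighbour of `v` and `r` in `G`.
  far⇒dominating-pair : ∀ {v r} → ¬ G.Near v r → ∀ x → H.Dominates v x ⊎ H.Dominates r x
  far⇒dominating-pair {v} {r} far x with v ≟ᶠ x | r ≟ᶠ x
  ... | yes v≡x | _       = inj₁ (inj₁ v≡x)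
  ... | no _    | yes r≡x = inj₂ (inj₁ r≡x)
  ... | no v≢x  | no r≢x with cover v≢x | cover r≢x
  ...   | inj₂ v≈x | _        = inj₁ (inj₂ v≈x)
  ...   | inj₁ _   | inj₂ r≈x = inj₂ (inj₂ r≈x)
  ...   | inj₁ v~x | inj₁ r~x = contradiction (x , inj₂ v~x , inj₂ (~-sym r~x)) far

  bg′≤3⊎bg′≤3 : bg′ G ≤ 3 ⊎ bg′ H ≤ 3
  bg′≤3⊎bg′≤3 with any? (λ v → any? λ r → ¬? (G.near? v r))
  ... | yes (v , r , far) = inj₂ (H.dominating-pair⇒bg′≤3 (far⇒dominating-pair far))
  ... | no ∄far = inj₁ (G.near⇒bg′≤3 λ v r →
    decidable-stable (G.near? v r) λ far → ∄far (v , r , far))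

-- The bounds on the product.

bg′≤3⇒product≤ : ∀ {n} {G H : Graph n} → Complementary G H → 6 ≤ n →
                 bg′ G ≤ 3 → bg′ G * bg′ H ≤ 3 * n ∸ 6
bg′≤3⇒product≤ {n} {G} {H} GH 6≤n bG≤3 with cherry? H
... | yes ch = ≤-trans (*-mono-≤ bG≤3 (Burning.bg′≤n∸2 H (≤-trans (m≤m+n 5 1) 6≤n) ch))
                       (≤-reflexive (*-distribˡ-∸ 3 n 2))
... | no ¬ch = ≤-trans
  (*-mono-≤ (no-cherry⇒bg′≤2 (complementary-sym GH) ¬ch) (Burning.bg′≤n H))
  -- `3 * n` unfolds to `n + 2 * n`, and the summand `n` absorbs the 6.
  (m+n≤o⇒m≤o∸n (2 * n) (≤-trans (+-monoʳ-≤ (2 * n) 6≤n) (≤-reflexive (+-comm (2 * n) n))))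

product≤ : ∀ {n} {G H : Graph n} → Complementary G H → 6 ≤ n → bg′ G * bg′ H ≤ 3 * n ∸ 6
product≤ {n} {G} {H} GH 6≤n with bg′≤3⊎bg′≤3 GH
... | inj₁ bG≤3 = bg′≤3⇒product≤ GH 6≤n bG≤3
... | inj₂ bH≤3 = subst (_≤ 3 * n ∸ 6) (*-comm (bg′ H) (bg′ G))
  (bg′≤3⇒product≤ (complementary-sym GH) 6≤n bH≤3)

8≤product : ∀ {n} {G H : Graph n} → Complementary G H → 6 ≤ n → 8 ≤ bg′ G * bg′ H
8≤product {n} {G} {H} GH 6≤n with cherry? G | cherry? H
... | no ¬chG | _       = *-mono-≤ (Burning.no-cherry⇒4≤bg′ G 6≤n ¬chG)
                                   (Burning.2≤bg′ H (≤-trans (m≤m+n 2 4) 6≤n))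
... | yes _   | no ¬chH = *-mono-≤ (Burning.2≤bg′ G (≤-trans (m≤m+n 2 4) 6≤n))
                                   (Burning.no-cherry⇒4≤bg′ H 6≤n ¬chH)
-- Both factors are at least 3, which gives 9.
... | yes chG | yes chH = ≤-trans (n≤1+n 8)
  (*-mono-≤ (cherry⇒3≤bg′ (complementary-sym GH) 3≤n chH) (cherry⇒3≤bg′ GH 3≤n chG))
  where
  3≤n : 3 ≤ n
  3≤n = ≤-trans (m≤m+n 3 3) 6≤n

theorem14 : ∀ (n : ℕ) → 6 ≤ n → (G : Graph n) →
    (8 ≤ bg′ G * bg′ (complement G)) × (bg′ G * bg′ (complement G) ≤ 3 * n ∸ 6)
theorem14 n 6≤n G = 8≤product GH 6≤n , product≤ GH 6≤n
  where
  GH : Complementary G (complement G)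
  GH = complement-complementary G
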